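{- Let $\mathbf{R}=\langle R,+,\cdot,0,1,\alpha\rangle$ be an orthomodular near semiring. Define $x\vee y=x+y$, $x'=\alpha(x)$ and $x\wedge y=(x'\vee y')'$ for $x,y\in R$. Then $\mathbf{L}(\mathbf{R})=\langle R,\vee,\wedge,{}',0,1\rangle$ is an orthomodular lattice.
   Context: A near semiring is an algebra $\langle R,+,\cdot,0,1\rangle$ such that: (i) $\langle R,+,0\rangle$ is a commutative monoid; (ii) $x\cdot 1=x=1\cdot x$ (multiplication need not be associative or commutative); (iii) $(x+y)\cdot z=(x\cdot z)+(y\cdot z)$; (iv) $x\cdot 0=0\cdot x=0$. It is idempotent if $x+x=x$; then $x\le y$ iff $x+y=y$ defines a partial order, called the induced order. An involutive near semiring is an idempotent near semiring with a map $\alpha:R\to R$ such that $\alpha(\alpha(x))=x$, and $x\le y$ implies $\alpha(y)\le\alpha(x)$. A Łukasiewicz near semiring is an involutive near semiring satisfying the identity $\alpha(x\cdot\alpha(y))\cdot\alpha(y)=\alpha(y\cdot\alpha(x))\cdot\alpha(x)$. An orthomodular near semiring is a Łukasiewicz near semiring satisfying the identity $x=x\cdot(x+y)$. An orthomodular lattice is an algebra $\langle L,\vee,\wedge,{}',0,1\rangle$ such that $\langle L,\vee,\wedge,0,1\rangle$ is a bounded lattice, $x\wedge x'=0$, $x\vee x'=1$, $x''=x$, $x\le y$ implies $y'\le x'$, and $x\le y$ implies $y=x\vee(y\wedge x')$. -}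

module Defs where

open import Algebra.Core using (Op₁; Op₂)
import Algebra.Definitions as AlgebraicDefinitions
import Algebra.Lattice.Structures as LatticeStructures
import Algebra.Structures as AlgebraicStructures
open import Level using (Level; suc; _⊔_)
open import Relation.Binary.Core using (Rel)
import Relation.Binary.Construct.NaturalOrder.Left as LeftNaturalOrder

module _ {a ℓ : Level} {A : Set a} (_≈_ : Rel A ℓ) where

  open AlgebraicDefinitions _≈_
  open AlgebraicStructures _≈_ using (IsCommutativeMonoid)
  open LatticeStructures _≈_ using (IsLattice)

  -- Unlike the structure of the same name in Algebra.Structures, this one has
  -- a commutative addition and a two-sided unit and zero for multiplication,
  -- and multiplication is not required to be associative.
  record IsNearSemiring (_+_ _*_ : Op₂ A) (0# 1# : A) : Set (a ⊔ ℓ) where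
    field
      +-isCommutativeMonoid : IsCommutativeMonoid _+_ 0#
      *-cong                : Congruent₂ _*_
      *-identity            : Identity 1# _*_
      distribʳ              : _*_ DistributesOverʳ _+_
      zero                  : Zero 0# _*_

    open IsCommutativeMonoid +-isCommutativeMonoid public
      using (isEquivalence; refl; sym; trans; reflexive; setoid)
      renaming
      ( assoc     to +-assoc
      ; comm      to +-comm
      ; identity  to +-identity
      ; identityˡ to +-identityˡ
      ; identityʳ to +-identityʳ
      ; ∙-cong    to +-cong
      ; ∙-congˡ   to +-congˡ
      ; ∙-congʳ   to +-congʳ
      )

  record IsIdempotentNearSemiring
         (_+_ _*_ : Op₂ A) (0# 1# : A) : Set (a ⊔ ℓ) where
    field
      isNearSemiring : IsNearSemiring _+_ _*_ 0# 1#
      +-idem         : Idempotent _+_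

    open IsNearSemiring isNearSemiring public

    infix 4 _≤_
    _≤_ : Rel A ℓ
    x ≤ y = (x + y) ≈ y

  record IsInvolutiveNearSemiring
         (_+_ _*_ : Op₂ A) (0# 1# : A) (α : Op₁ A) : Set (a ⊔ ℓ) where
    field
      isIdempotentNearSemiring : IsIdempotentNearSemiring _+_ _*_ 0# 1#

    open IsIdempotentNearSemiring isIdempotentNearSemiring public

    field
      α-cong       : Congruent₁ α
      α-involutive : Involutive α
      α-antitone   : ∀ {x y} → x ≤ y → α y ≤ α x

  record IsŁukasiewiczNearSemiring
         (_+_ _*_ : Op₂ A) (0# 1# : A) (α : Op₁ A) : Set (a ⊔ ℓ) where
    field
      isInvolutiveNearSemiring : IsInvolutiveNearSemiring _+_ _*_ 0# 1# α
      łukasiewicz              : ∀ x y →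
        (α (x * α y) * α y) ≈ (α (y * α x) * α x)

    open IsInvolutiveNearSemiring isInvolutiveNearSemiring public

  record IsOrthomodularNearSemiring
         (_+_ _*_ : Op₂ A) (0# 1# : A) (α : Op₁ A) : Set (a ⊔ ℓ) where
    field
      isŁukasiewiczNearSemiring : IsŁukasiewiczNearSemiring _+_ _*_ 0# 1# α
      orthomodular              : ∀ x y → x ≈ (x * (x + y))

    open IsŁukasiewiczNearSemiring isŁukasiewiczNearSemiring public

  record IsBoundedLattice (_∨_ _∧_ : Op₂ A) (0# 1# : A) : Set (a ⊔ ℓ) where
    field
      isLattice  : IsLattice _∨_ _∧_
      ∨-identity : Identity 0# _∨_
      ∧-identity : Identity 1# _∧_

    open IsLattice isLattice public

    -- x ≤ y is x ≈ (x ∧ y), as in Algebra.Lattice.Properties.Lattice.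
    open LeftNaturalOrder _≈_ _∧_ public using (_≤_)

  record IsOrthomodularLattice
         (_∨_ _∧_ : Op₂ A) (_′ : Op₁ A) (0# 1# : A) : Set (a ⊔ ℓ) where
    field
      isBoundedLattice : IsBoundedLattice _∨_ _∧_ 0# 1#

    open IsBoundedLattice isBoundedLattice public

    field
      ′-cong         : Congruent₁ _′
      ∧-complementʳ  : RightInverse 0# _′ _∧_
      ∨-complementʳ  : RightInverse 1# _′ _∨_
      ′-involutive   : Involutive _′
      ′-antitone     : ∀ {x y} → x ≤ y → (y ′) ≤ (x ′)
      orthomodular   : ∀ {x y} → x ≤ y → y ≈ (x ∨ (y ∧ (x ′)))

record OrthomodularNearSemiring (c ℓ : Level) : Set (suc (c ⊔ ℓ)) where
  infix  8 _′
  infixl 7 _*_ _∧_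
  infixl 6 _+_ _∨_
  infix  4 _≈_
  field
    Carrier                    : Set c
    _≈_                        : Rel Carrier ℓ
    _+_                        : Op₂ Carrier
    _*_                        : Op₂ Carrier
    0#                         : Carrier
    1#                         : Carrier
    α                          : Op₁ Carrier
    isOrthomodularNearSemiring : IsOrthomodularNearSemiring _≈_ _+_ _*_ 0# 1# α

  open IsOrthomodularNearSemiring isOrthomodularNearSemiring public

  _∨_ : Op₂ Carrier
  x ∨ y = x + y

  _′ : Op₁ Carrier
  x ′ = α x

  _∧_ : Op₂ Carrier
  x ∧ y = (x ′ ∨ y ′) ′

{-# OPTIONS --safe #-}

-- The Łukasiewicz identity gives α y ≈ α (y * α x) * α x for x ≤ y, so among
-- the elements above x, y is determined by its product with α x.  Comparing y
-- with y * α x + y yields y * α x ≤ y, and comparing it with x + y * α x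
-- yields y ≈ x + y * α x.  Since y * α x is a lower bound of y and α x, the
-- latter is the orthomodular law.

module Submission where

open import Defs
open import Data.Product using (_,_; proj₁; proj₂)
open import Level using (Level)
import Algebra.Definitions as AlgebraicDefinitions
import Relation.Binary.Reasoning.Setoid as ≈-Reasoning

module OrthomodularNearSemiringProperties
  {c ℓ : Level} (R : OrthomodularNearSemiring c ℓ) where

  open OrthomodularNearSemiring R
  open AlgebraicDefinitions _≈_
  open ≈-Reasoning setoid

  ≤-trans : ∀ {x y z} → x ≤ y → y ≤ z → x ≤ z
  ≤-trans {x} {y} {z} x≤y y≤z = begin
    x + z        ≈⟨ +-congˡ y≤z ⟨
    x + (y + z)  ≈⟨ +-assoc x y z ⟨
    x + y + z    ≈⟨ +-congʳ x≤y ⟩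
    y + z        ≈⟨ y≤z ⟩
    z            ∎

  ≤-antisym : ∀ {x y} → x ≤ y → y ≤ x → x ≈ y
  ≤-antisym {x} {y} x≤y y≤x = trans (sym y≤x) (trans (+-comm y x) x≤y)

  ≤-respˡ-≈ : ∀ {x y z} → x ≈ y → x ≤ z → y ≤ z
  ≤-respˡ-≈ x≈y x≤z = trans (+-congʳ (sym x≈y)) x≤z

  ≤-respʳ-≈ : ∀ {x y z} → y ≈ z → x ≤ y → x ≤ z
  ≤-respʳ-≈ y≈z x≤y = trans (+-congˡ (sym y≈z)) (trans x≤y y≈z)

  x≤x+y : ∀ x y → x ≤ x + y
  x≤x+y x y = trans (sym (+-assoc x x y)) (+-congʳ (+-idem x))

  y≤x+y : ∀ x y → y ≤ x + y
  y≤x+y x y = ≤-respʳ-≈ (+-comm y x) (x≤x+y y x)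

  +-least : ∀ {x y z} → x ≤ z → y ≤ z → x + y ≤ z
  +-least x≤z y≤z = trans (+-assoc _ _ _) (trans (+-congˡ y≤z) x≤z)

  0≤x : ∀ x → 0# ≤ x
  0≤x = +-identityˡ

  x≤0⇒x≈0 : ∀ {x} → x ≤ 0# → x ≈ 0#
  x≤0⇒x≈0 x≤0 = ≤-antisym x≤0 (0≤x _)

  -- The identity `x ≈ x * (x + y)` taken at the unit `1#` makes the unit the top element.
  x≤1 : ∀ x → x ≤ 1#
  x≤1 x = begin
    x + 1#         ≈⟨ +-comm x 1# ⟩
    1# + x         ≈⟨ proj₁ *-identity (1# + x) ⟨
    1# * (1# + x)  ≈⟨ orthomodular 1# x ⟨
    1#             ∎

  α-injective : ∀ {x y} → α x ≈ α y → x ≈ y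
  α-injective {x} {y} eq =
    trans (sym (α-involutive x)) (trans (α-cong eq) (α-involutive y))

  α1≈0 : α 1# ≈ 0#
  α1≈0 = x≤0⇒x≈0 (≤-respʳ-≈ (α-involutive 0#) (α-antitone (x≤1 (α 0#))))

  α0≈1 : α 0# ≈ 1#
  α0≈1 = α-injective (trans (α-involutive 0#) (sym α1≈0))

  -- As an antitone involution, `α` turns the joins given by `+` into meets; this and the next two
  -- facts are the duals of those for `+`.
  x∧y≤x : ∀ x y → x ∧ y ≤ x
  x∧y≤x x y = ≤-respʳ-≈ (α-involutive x) (α-antitone (x≤x+y (α x) (α y)))

  x∧y≤y : ∀ x y → x ∧ y ≤ y
  x∧y≤y x y = ≤-respʳ-≈ (α-involutive y) (α-antitone (y≤x+y (α x) (α y)))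

  ∧-greatest : ∀ {x y z} → z ≤ x → z ≤ y → z ≤ x ∧ y
  ∧-greatest {z = z} z≤x z≤y = ≤-respˡ-≈ (α-involutive z)
    (α-antitone (+-least (α-antitone z≤x) (α-antitone z≤y)))

  x≤y⇒x∧y≈x : ∀ {x y} → x ≤ y → x ∧ y ≈ x
  x≤y⇒x∧y≈x {x} {y} x≤y =
    ≤-antisym (x∧y≤x x y) (∧-greatest (+-idem x) x≤y)

  -- Passes from the order of the lattice, defined by `∧`, to the induced order, defined by `+`.
  x≈x∧y⇒x≤y : ∀ {x y} → x ≈ x ∧ y → x ≤ y
  x≈x∧y⇒x≤y {x} {y} eq = ≤-respˡ-≈ (sym eq) (x∧y≤y x y)

  ∧-cong : Congruent₂ _∧_
  ∧-cong x≈y u≈v = α-cong (+-cong (α-cong x≈y) (α-cong u≈v))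

  ∧-comm : Commutative _∧_
  ∧-comm x y = α-cong (+-comm (α x) (α y))

  ∧-assoc : Associative _∧_
  ∧-assoc x y z = α-cong (begin
    α (x ∧ y) + α z    ≈⟨ +-congʳ (α-involutive _) ⟩
    α x + α y + α z    ≈⟨ +-assoc (α x) (α y) (α z) ⟩
    α x + (α y + α z)  ≈⟨ +-congˡ (α-involutive _) ⟨
    α x + α (y ∧ z)    ∎)

  ∧-identityʳ : RightIdentity 1# _∧_
  ∧-identityʳ x = x≤y⇒x∧y≈x (x≤1 x)

  ∧-identityˡ : LeftIdentity 1# _∧_
  ∧-identityˡ x = trans (∧-comm 1# x) (∧-identityʳ x)

  ∨-absorbs-∧ : _∨_ Absorbs _∧_
  ∨-absorbs-∧ x y = trans (+-comm x (x ∧ y)) (x∧y≤x x y)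

  ∧-absorbs-∨ : _∧_ Absorbs _∨_
  ∧-absorbs-∨ x y = x≤y⇒x∧y≈x (x≤x+y x y)

  *-monoˡ-≤ : ∀ z {x y} → x ≤ y → x * z ≤ y * z
  *-monoˡ-≤ z {x} {y} x≤y =
    trans (sym (distribʳ z x y)) (*-cong x≤y refl)

  x*y≤y : ∀ x y → x * y ≤ y
  x*y≤y x y = ≤-respʳ-≈ (proj₁ *-identity y) (*-monoˡ-≤ y (x≤1 x))

  -- For `x ≤ y` the factor `x + y` in the orthomodular identity is `y` itself.
  x≤y⇒x*y≈x : ∀ {x y} → x ≤ y → x * y ≈ x
  x≤y⇒x*y≈x {x} {y} x≤y =
    trans (*-cong refl (sym x≤y)) (sym (orthomodular x y))

  -- In the Łukasiewicz identity for `x` and `1#`, the factor `α 1# ≈ 0#` annihilates one side, and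
  -- the other reduces to `x * α x`.
  x*αx≈0 : ∀ x → x * α x ≈ 0#
  x*αx≈0 x = begin
    x * α x                ≈⟨ *-cong (α-involutive x) refl ⟨
    α (α x) * α x          ≈⟨ *-cong (α-cong (proj₁ *-identity (α x))) refl ⟨
    α (1# * α x) * α x     ≈⟨ łukasiewicz x 1# ⟨
    α (x * α 1#) * α 1#    ≈⟨ *-cong refl α1≈0 ⟩
    α (x * α 1#) * 0#      ≈⟨ proj₂ zero _ ⟩
    0#                     ∎

  αx*x≈0 : ∀ x → α x * x ≈ 0#
  αx*x≈0 x = trans (*-cong refl (sym (α-involutive x))) (x*αx≈0 (α x))

  x≤y⇒α[y*αx]*αx≈αy : ∀ {x y} → x ≤ y → α (y * α x) * α x ≈ α y
  x≤y⇒α[y*αx]*αx≈αy {x} {y} x≤y = begin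
    α (y * α x) * α x  ≈⟨ łukasiewicz x y ⟨
    α (x * α y) * α y  ≈⟨ *-cong (α-cong x*αy≈0) refl ⟩
    α 0# * α y         ≈⟨ *-cong α0≈1 refl ⟩
    1# * α y           ≈⟨ proj₁ *-identity (α y) ⟩
    α y                ∎
    where
    x*αy≈0 : x * α y ≈ 0#
    -- Right multiplication is monotone, so `x * α y` lies below `y * α y`, which vanishes.
    x*αy≈0 = x≤0⇒x≈0 (≤-respʳ-≈ (x*αx≈0 y) (*-monoˡ-≤ (α y) x≤y))

  *α-cancelʳ-above : ∀ {x y z} → x ≤ y → x ≤ z → y * α x ≈ z * α x → y ≈ z
  *α-cancelʳ-above {x} {y} {z} x≤y x≤z eq = α-injective (begin
    α y                ≈⟨ x≤y⇒α[y*αx]*αx≈αy x≤y ⟨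
    α (y * α x) * α x  ≈⟨ *-cong (α-cong eq) refl ⟩
    α (z * α x) * α x  ≈⟨ x≤y⇒α[y*αx]*αx≈αy x≤z ⟩
    α z                ∎)

  *-idemʳ : ∀ x y → x * y * y ≈ x * y
  *-idemʳ x y = x≤y⇒x*y≈x (x*y≤y x y)

  x≤y⇒y*αx≤y : ∀ {x y} → x ≤ y → y * α x ≤ y
  x≤y⇒y*αx≤y {x} {y} x≤y =
    -- The goal unfolds to `y * α x + y ≈ y`, an equation between two elements above `x`.
    *α-cancelʳ-above (≤-trans x≤y (y≤x+y (y * α x) y)) x≤y (begin
      (y * α x + y) * α x        ≈⟨ distribʳ (α x) (y * α x) y ⟩
      y * α x * α x + y * α x    ≈⟨ +-congʳ (*-idemʳ y (α x)) ⟩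
      y * α x + y * α x          ≈⟨ +-idem (y * α x) ⟩
      y * α x                    ∎)

  x≤y⇒x+y*αx≈y : ∀ {x y} → x ≤ y → x + y * α x ≈ y
  x≤y⇒x+y*αx≈y {x} {y} x≤y =
    *α-cancelʳ-above (x≤x+y x (y * α x)) x≤y (begin
      (x + y * α x) * α x        ≈⟨ distribʳ (α x) x (y * α x) ⟩
      x * α x + y * α x * α x    ≈⟨ +-cong (x*αx≈0 x) (*-idemʳ y (α x)) ⟩
      0# + y * α x               ≈⟨ +-identityˡ (y * α x) ⟩
      y * α x                    ∎)

  x≤y⇒y≈x∨y∧x′ : ∀ {x y} → x ≤ y → y ≈ x ∨ (y ∧ x ′)
  x≤y⇒y≈x∨y∧x′ {x} {y} x≤y = ≤-antisym
    -- Write `y` as `x + y * α x` and enlarge the second summand to `y ∧ α x`.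
    (≤-respˡ-≈ (x≤y⇒x+y*αx≈y x≤y)
      (+-least (x≤x+y x _) (≤-trans y*αx≤y∧αx (y≤x+y x _))))
    (+-least x≤y (x∧y≤x y (α x)))
    where
    y*αx≤y∧αx : y * α x ≤ y ∧ α x
    y*αx≤y∧αx = ∧-greatest (x≤y⇒y*αx≤y x≤y) (x*y≤y y (α x))

  -- Let `m` be `x ∧ α x`. From `m ≤ x` comes `m * x ≈ m`, and from `m ≤ α x` comes
  -- `m * x ≤ α x * x ≈ 0#`.
  ∧-complementʳ : RightInverse 0# _′ _∧_
  ∧-complementʳ x = x≤0⇒x≈0
    (≤-respˡ-≈ (x≤y⇒x*y≈x (x∧y≤x x (α x)))
      (≤-respʳ-≈ (αx*x≈0 x) (*-monoˡ-≤ x (x∧y≤y x (α x)))))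

  -- De Morgan dual of the previous law, obtained by comparing both sides under `α`.
  ∨-complementʳ : RightInverse 1# _′ _∨_
  ∨-complementʳ x = α-injective (begin
    α (x + α x)          ≈⟨ α-cong (+-comm x (α x)) ⟩
    α (α x + x)          ≈⟨ α-cong (+-congˡ (α-involutive x)) ⟨
    x ∧ x ′              ≈⟨ ∧-complementʳ x ⟩
    0#                   ≈⟨ α1≈0 ⟨
    α 1#                 ∎)

  isOrthomodularLattice : IsOrthomodularLattice _≈_ _∨_ _∧_ _′ 0# 1#
  isOrthomodularLattice = record
    { isBoundedLattice = record
      { isLattice = record
        { isEquivalence = isEquivalence
        ; ∨-comm        = +-comm
        ; ∨-assoc       = +-assoc
        ; ∨-cong        = +-cong
        ; ∧-comm        = ∧-comm
        ; ∧-assoc       = ∧-assoc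
        ; ∧-cong        = ∧-cong
        ; absorptive    = ∨-absorbs-∧ , ∧-absorbs-∨
        }
      ; ∨-identity = +-identity
      ; ∧-identity = ∧-identityˡ , ∧-identityʳ
      }
    ; ′-cong        = α-cong
    ; ∧-complementʳ = ∧-complementʳ
    ; ∨-complementʳ = ∨-complementʳ
    ; ′-involutive  = α-involutive
    -- The hypothesis is moved to the induced order, where `α` is antitone, and the result is moved
    -- back to the lattice order.
    ; ′-antitone    = λ x≤y → sym (x≤y⇒x∧y≈x (α-antitone (x≈x∧y⇒x≤y x≤y)))
    ; orthomodular  = λ x≤y → x≤y⇒y≈x∨y∧x′ (x≈x∧y⇒x≤y x≤y)
    }

theorem10 : (c ℓ : Level) (R : OrthomodularNearSemiring c ℓ) →
    let open OrthomodularNearSemiring R in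
    IsOrthomodularLattice _≈_ _∨_ _∧_ _′ 0# 1#
theorem10 c ℓ R = OrthomodularNearSemiringProperties.isOrthomodularLattice R
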